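{- $\mathbf{InqB}=\mathbf{InqKhL}$; that is, for every $\alpha\in\mathbf{PL}$, $\alpha$ is supported by every state in every model if and only if $M,w\vDash\mathsf{Kh}\alpha$ for every model $M$ and every world $w$ of $M$.
   Context: Fix a countable set $\mathbf{P}$ of proposition letters. $\mathbf{PL}$ is the set of formulas $\alpha::=p\mid\bot\mid(\alpha\land\alpha)\mid(\alpha\lor\alpha)\mid(\alpha\to\alpha)$ with $p\in\mathbf{P}$. A model is $M=\langle W,V\rangle$ with $W$ a non-empty set (of worlds) and $V:W\to\wp(\mathbf{P})$. Inquisitive semantics. A state in $M$ is any subset $s\subseteq W$ (possibly empty). Support $M,s\Vdash\alpha$ is defined by: $M,s\Vdash p$ iff $p\in V(w)$ for all $w\in s$; $M,s\Vdash\bot$ iff $s=\varnothing$; $M,s\Vdash\alpha\land\beta$ iff $M,s\Vdash\alpha$ and $M,s\Vdash\beta$; $M,s\Vdash\alpha\lor\beta$ iff $M,s\Vdash\alpha$ or $M,s\Vdash\beta$; $M,s\Vdash\alpha\to\beta$ iff for all $t\subseteq s$, $M,t\Vdash\alpha$ implies $M,t\Vdash\beta$. $\mathbf{InqB}$ (inquisitive logic) is the set of $\alpha\in\mathbf{PL}$ supported by all states in all models. Know-how semantics. The resolution space $S(\alpha)$ is defined by: $S(p)=\{p\}$; $S(\bot)=\{\bot\}$; $S(\alpha\lor\beta)=(S(\alpha)\times\{0\})\cup(S(\beta)\times\{1\})$; $S(\alpha\land\beta)=S(\alpha)\times S(\beta)$; $S(\alpha\to\beta)=S(\beta)^{S(\alpha)}$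 (all functions from $S(\alpha)$ to $S(\beta)$). For a world $w$ of $M$, the set of actual resolutions $R(w,\alpha)\subseteq S(\alpha)$ is: $R(w,\bot)=\varnothing$; $R(w,p)=\{p\}$ if $p\in V(w)$ and $\varnothing$ otherwise; $R(w,\alpha\lor\beta)=(R(w,\alpha)\times\{0\})\cup(R(w,\beta)\times\{1\})$; $R(w,\alpha\land\beta)=R(w,\alpha)\times R(w,\beta)$; $R(w,\alpha\to\beta)=\{f\in S(\beta)^{S(\alpha)}\mid f[R(w,\alpha)]\subseteq R(w,\beta)\}$. For $w\in W$: $M,w\vDash\mathsf{Kh}\alpha$ iff there is $x\in S(\alpha)$ such that $x\in R(v,\alpha)$ for all $v\in W$. $\mathbf{InqKhL}$ is the set of $\alpha\in\mathbf{PL}$ such that $\mathsf{Kh}\alpha$ is valid, i.e. $M,w\vDash\mathsf{Kh}\alpha$ for every model $M$ and world $w$ of $M$. -}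

module Defs where

open import Data.Empty using (⊥)
open import Data.Product using (_×_; ∃)
open import Data.Sum using (_⊎_)
open import Level using (Level; Lift; suc)
open import Relation.Unary
  using (Pred; _∈_; _⊆_; ｛_｝; Empty; _⟨×⟩_; _⟨⊎⟩_; _⟨→⟩_)

infixr 7 _∧_
infixr 6 _∨_
infixr 5 _⇒_
infix  4 _,_⊩_ _,_⊨Kh_

data PL (P : Set) : Set where
  atom : P → PL P
  bot  : PL P
  _∧_  : PL P → PL P → PL P
  _∨_  : PL P → PL P → PL P
  _⇒_  : PL P → PL P → PL P

-- Subsets are `Set ℓ`-valued predicates.  Worlds, valuations and states share
-- the level ℓ, so that the worlds of a state again form a type in `Set ℓ`.

record Model (P : Set) (ℓ : Level) : Set (suc ℓ) where
  field
    W        : Set ℓ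
    nonEmpty : W
    V        : W → Pred P ℓ

open Model public

State : {P : Set} {ℓ : Level} → Model P ℓ → Set (suc ℓ)
State {ℓ = ℓ} M = Pred (W M) ℓ

_,_⊩_ : {P : Set} {ℓ : Level} (M : Model P ℓ) → State M → PL P → Set (suc ℓ)
_,_⊩_ {ℓ = ℓ} M s (atom p) = Lift (suc ℓ) (∀ {w} → w ∈ s → p ∈ V M w)
_,_⊩_ {ℓ = ℓ} M s bot      = Lift (suc ℓ) (Empty s)
M , s ⊩ (α ∧ β) = (M , s ⊩ α) × (M , s ⊩ β)
M , s ⊩ (α ∨ β) = (M , s ⊩ α) ⊎ (M , s ⊩ β)
M , s ⊩ (α ⇒ β) = (t : State M) → t ⊆ s → M , t ⊩ α → M , t ⊩ β

InqB : (P : Set) (ℓ : Level) → Pred (PL P) (suc ℓ)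
InqB P ℓ α = (M : Model P ℓ) (s : State M) → M , s ⊩ α

-- `∃ ｛ x ｝` is the singleton {x} regarded as a type; the tagged union
-- (S α × {0}) ∪ (S β × {1}) is the sum type.

S : {P : Set} → PL P → Set
S (atom p) = ∃ ｛ p ｝
S {P} bot  = ∃ {A = PL P} ｛ bot ｝
S (α ∨ β)  = S α ⊎ S β
S (α ∧ β)  = S α × S β
S (α ⇒ β)  = S α → S β

-- In the last clause, f ∈ A ⟨→⟩ B unfolds to: x ∈ A implies f x ∈ B,
-- that is, f[A] ⊆ B.

R : {P : Set} {ℓ : Level} (M : Model P ℓ) → W M → (α : PL P) → Pred (S α) ℓ
R M w (atom p) _ = p ∈ V M w
R {ℓ = ℓ} M w bot _ = Lift ℓ ⊥
R M w (α ∨ β) = R M w α ⟨⊎⟩ R M w β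
R M w (α ∧ β) = R M w α ⟨×⟩ R M w β
R M w (α ⇒ β) = R M w α ⟨→⟩ R M w β

_,_⊨Kh_ : {P : Set} {ℓ : Level} (M : Model P ℓ) → W M → PL P → Set ℓ
M , w ⊨Kh α = ∃ λ (x : S α) → ∀ v → x ∈ R M v α

InqKhL : (P : Set) (ℓ : Level) → Pred (PL P) (suc ℓ)
InqKhL P ℓ α = (M : Model P ℓ) (w : W M) → M , w ⊨Kh α

{-# OPTIONS --safe #-}

-- A state supports α exactly when some single resolution of α is actual at
-- all of its worlds.  The theorem is the case of the full state, since a
-- common resolution for all worlds is one for every state.

module Submission where

open import Defs
open import Data.Nat using (ℕ)
open import Data.Product using (_,_; ∃; proj₁; proj₂)
open import Data.Sum using (inj₁; inj₂)
open import Data.Unit.Polymorphic using (⊤; tt)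
open import Function.Base using (_∘_)
open import Function.Bundles using (_↣_)
open import Level using (Level; lift; lower)
open import Relation.Binary.PropositionalEquality using (refl)
open import Relation.Unary using (_∈_; _⊆_; _∩_; _≐_)

module _ {P : Set} {ℓ : Level} (M : Model P ℓ) where

  CommonResolution : State M → PL P → Set _
  CommonResolution s α = ∃ λ (x : S α) → s ⊆ λ w → x ∈ R M w α

  -- Simultaneous induction with the converse: the antecedent of an implication is contravariant, so
  -- there each direction calls the other.
  common⇒support : ∀ α (s : State M) → CommonResolution s α → M , s ⊩ α
  support⇒common : ∀ α (s : State M) → M , s ⊩ α → CommonResolution s α

  common⇒support (atom p) s (x , x∈R) = lift x∈R
  common⇒support bot      s (x , x∈R) = lift λ w w∈s → lower (x∈R w∈s)
  common⇒support (α ∧ β)  s ((x , y) , xy∈R) =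
    common⇒support α s (x , proj₁ ∘ xy∈R) , common⇒support β s (y , proj₂ ∘ xy∈R)
  -- The tag is shared by all worlds of `s`, so it selects one disjunct for the whole state.
  common⇒support (α ∨ β)  s (inj₁ x , x∈R) = inj₁ (common⇒support α s (x , x∈R))
  common⇒support (α ∨ β)  s (inj₂ y , y∈R) = inj₂ (common⇒support β s (y , y∈R))
  common⇒support (α ⇒ β)  s (f , f∈R) t t⊆s t⊩α =
    let x , x∈R = support⇒common α t t⊩α
    in common⇒support β t (f x , λ w∈t → f∈R (t⊆s w∈t) (x∈R w∈t))

  support⇒common (atom p) s (lift s⊆p) = (p , refl) , s⊆p
  support⇒common bot      s (lift s-empty) = (bot , refl) , λ {w} w∈s → lift (s-empty w w∈s)
  support⇒common (α ∧ β)  s (s⊩α , s⊩β) =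
    let x , x∈R = support⇒common α s s⊩α
        y , y∈R = support⇒common β s s⊩β
    in (x , y) , λ w∈s → x∈R w∈s , y∈R w∈s
  support⇒common (α ∨ β)  s (inj₁ s⊩α) =
    let x , x∈R = support⇒common α s s⊩α in inj₁ x , x∈R
  support⇒common (α ∨ β)  s (inj₂ s⊩β) =
    let y , y∈R = support⇒common β s s⊩β in inj₂ y , y∈R
  -- The resolution chosen for x resolves β on the largest substate of s on which x resolves α.
  support⇒common (α ⇒ β)  s s⊩α⇒β =
    (λ x → proj₁ (resolve x)) , λ w∈s {x} x∈R → proj₂ (resolve x) (w∈s , x∈R)
    where
    restrict : S α → State M
    restrict x = s ∩ λ w → x ∈ R M w α

    resolve : ∀ x → CommonResolution (restrict x) β
    -- By construction `x` is actual throughout `restrict x`, which therefore supports `α`.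
    resolve x = support⇒common β (restrict x)
      (s⊩α⇒β (restrict x) proj₁ (common⇒support α (restrict x) (x , proj₂)))

corollary36 : (P : Set) → P ↣ ℕ → ∀ ℓ → InqB P ℓ ≐ InqKhL P ℓ
corollary36 P _ ℓ = InqB⊆InqKhL , InqKhL⊆InqB
  where
  InqB⊆InqKhL : InqB P ℓ ⊆ InqKhL P ℓ
  InqB⊆InqKhL {α} α∈InqB M _ =
    let x , x∈R = support⇒common M α (λ _ → ⊤) (α∈InqB M (λ _ → ⊤))
    in x , λ v → x∈R {v} tt

  InqKhL⊆InqB : InqKhL P ℓ ⊆ InqB P ℓ
  InqKhL⊆InqB {α} α∈InqKhL M s =
    -- `s` may be empty, so the world of evaluation comes from the model.
    let x , x∈R = α∈InqKhL M (nonEmpty M)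
    in common⇒support M α s (x , λ {w} _ → x∈R w)
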